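{- There exists a deterministic algorithm that finds the sink of any $n$-dimensional realizable Matoušek-type USO using $O(\log^2 n)$ vertex evaluations in the worst case.
   Context: All vectors and matrices are over $GF(2)$; $\oplus$ denotes xor. The $n$-dimensional hypercube has vertex set $\{0,1\}^n$, with vertices adjacent iff they differ in exactly one coordinate. An orientation is given by an outmap $o:\{0,1\}^n\to\{0,1\}^n$, the edge $\{v,v\oplus e_i\}$ being directed away from $v$ iff $o(v)_i=1$ (with $o(v)_i\neq o(v\oplus e_i)_i$). A USO is an orientation in which every non-empty face has a unique sink. An $n$-dimensional Matoušek-type USO is an orientation $o(v)=M(v\oplus s)$ where $M=PAP^T$ for a permutation matrix $P$ and an invertible upper-triangular $A\in\{0,1\}^{n\times n}$, and $s\in\{0,1\}^n$ is its sink. Its dimension influence graph is the directed graph on $[n]$ with an edge $(i,j)$ iff $M_{j,i}=1$. A USO is realizable if it is produced by the (Stickney–Watson) reduction from some non-degenerate P-matrix Linear Complementarity Problem instance to USO sink-finding; for Matoušek-type USOs it is known that this holds iff the dimension influence graph is the reflexive transitive closure of a branching (a forest of rooted trees with all edges directed away from the roots). A sink-finding algorithm accesses the USO only via vertex evaluations: querying $v$ returns $o(v)$. -}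

module Defs where

open import Algebra.Bundles using (CommutativeRing)
open import Data.Bool.Base using (Bool; true; false; not; if_then_else_; _xor_)
open import Data.Bool.Properties using (xor-∧-commutativeRing)
open import Data.Fin.Base as Fin using (Fin; zero; suc; toℕ; punchIn)
open import Data.Fin.Permutation using (Permutation′; _⟨$⟩ʳ_)
open import Data.Fin.Properties using (_≟_)
open import Data.Fin.Subset using (Subset; _∈_; _∉_)
open import Data.Nat.Base using (ℕ; zero; suc)
open import Data.Product using (∃-syntax; ∃!; _×_)
open import Data.Vec.Base using (Vec; lookup; tabulate; zipWith; _[_]%=_)
open import Data.Vec.Functional using (Vector)
open import Function.Bundles using (_⇔_)
open import Level using (_⊔_) renaming (suc to lsuc)
open import Relation.Binary.Core using (Rel)
open import Relation.Binary.PropositionalEquality.Core using (_≡_; _≢_)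
open import Relation.Binary.Structures using (IsStrictTotalOrder)
open import Relation.Nullary.Decidable.Core using (does)
open import Relation.Nullary.Negation.Core using (¬_)

module LinearAlgebra {c ℓ} (R : CommutativeRing c ℓ) where

  open CommutativeRing R hiding (zero)
  open import Algebra.Properties.Semiring.Sum semiring using (sum)
  open import Algebra.Properties.Semiring.Exp semiring using (_^_)

  Matrix : ℕ → Set c
  Matrix n = Fin n → Fin n → Carrier

  infix  4 _≈ᴹ_
  infixl 7 _*ᴹ_
  infixr 7 _*ⱽ_
  infix  8 _ᵀ

  _≈ᴹ_ : ∀ {n} → Matrix n → Matrix n → Set ℓ
  A ≈ᴹ B = ∀ i j → A i j ≈ B i j

  1ᴹ : ∀ {n} → Matrix n
  1ᴹ i j = if does (i ≟ j) then 1# else 0#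

  _*ᴹ_ : ∀ {n} → Matrix n → Matrix n → Matrix n
  (A *ᴹ B) i k = sum λ j → A i j * B j k

  _*ⱽ_ : ∀ {n} → Matrix n → Vector Carrier n → Vector Carrier n
  (A *ⱽ x) i = sum λ j → A i j * x j

  _ᵀ : ∀ {n} → Matrix n → Matrix n
  (A ᵀ) i j = A j i

  Invertible : ∀ {n} → Matrix n → Set (c ⊔ ℓ)
  Invertible A = ∃[ B ] A *ᴹ B ≈ᴹ 1ᴹ × B *ᴹ A ≈ᴹ 1ᴹ

  UpperTriangular : ∀ {n} → Matrix n → Set ℓ
  UpperTriangular A = ∀ i j → j Fin.< i → A i j ≈ 0#

  permutationMatrix : ∀ {n} → Permutation′ n → Matrix n
  permutationMatrix π i j = 1ᴹ (π ⟨$⟩ʳ i) j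

  -- Laplace expansion along the first row; the 0 × 0 determinant is 1.
  det : ∀ {n} → Matrix n → Carrier
  det {zero}  A = 1#
  det {suc n} A =
    sum λ j → (- 1#) ^ toℕ j * (A zero j * det λ i k → A (suc i) (punchIn j k))

-- Stands in for the reals, of which only the ordered-field axioms are used.
record OrderedField c ℓ₁ ℓ₂ : Set (lsuc (c ⊔ ℓ₁ ⊔ ℓ₂)) where
  field
    commutativeRing : CommutativeRing c ℓ₁

  open CommutativeRing commutativeRing public

  infix 4 _<_
  field
    _<_                : Rel Carrier ℓ₂
    isStrictTotalOrder : IsStrictTotalOrder _≈_ _<_
    0≉1                : ¬ (0# ≈ 1#)
    inverse            : ∀ x → ¬ (x ≈ 0#) → ∃[ y ] x * y ≈ 1#
    +-monoˡ-<          : ∀ z {x y} → x < y → x + z < y + z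
    *-pos              : ∀ {x y} → 0# < x → 0# < y → 0# < x * y

-- The elements of GF(2) are Booleans: addition is xor, multiplication is ∧.
module GF2 = LinearAlgebra xor-∧-commutativeRing

Vertex : ℕ → Set
Vertex n = Vec Bool n

infixl 6 _⊕_
_⊕_ : ∀ {n} → Vertex n → Vertex n → Vertex n
_⊕_ = zipWith _xor_

neighbour : ∀ {n} → Vertex n → Fin n → Vertex n
neighbour v i = v [ i ]%= not

OnFace : ∀ {n} → Subset n → Vertex n → Vertex n → Set
OnFace I v u = ∀ i → i ∉ I → lookup u i ≡ lookup v i

record USO (n : ℕ) : Set where
  field
    outmap     : Vertex n → Vertex n
    consistent : ∀ v i →
                 lookup (outmap v) i ≢ lookup (outmap (neighbour v i)) i
    -- The face through v spanned by the dimensions in I has a unique sink.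
    uniqueSink : ∀ I v → ∃! _≡_ λ u →
                 OnFace I v u × (∀ i → i ∈ I → lookup (outmap u) i ≡ false)

open USO public

IsSink : ∀ {n} → USO n → Vertex n → Set
IsSink o v = ∀ i → lookup (outmap o v) i ≡ false

record IsMatoušekType {n} (o : USO n) : Set where
  open GF2
  field
    π               : Permutation′ n
    A               : Matrix n
    s               : Vertex n
    invertible      : Invertible A
    upperTriangular : UpperTriangular A

  P : Matrix n
  P = permutationMatrix π

  M : Matrix n
  M = P *ᴹ A *ᴹ P ᵀ

  field
    outmap-eq : ∀ v → outmap o v ≡ tabulate (M *ⱽ lookup (v ⊕ s))

module _ {c ℓ₁ ℓ₂} (K : OrderedField c ℓ₁ ℓ₂) where

  open OrderedField K
  open LinearAlgebra commutativeRing

  -- All principal minors are positive; f enumerates the chosen indices.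
  IsPMatrix : ∀ {n} → Matrix n → Set ℓ₂
  IsPMatrix {n} M = ∀ {k} (f : Fin k → Fin n) →
    (∀ {i j} → i Fin.< j → f i Fin.< f j) →
    0# < det λ i j → M (f i) (f j)

  -- For the LCP  w - M z = q,  w , z ≥ 0,  wᵀ z = 0,  column j of the basis at
  -- v is the column of z j if v j = 1, and the column of w j otherwise.
  basis : ∀ {n} → Matrix n → Vertex n → Matrix n
  basis M v i j = if lookup v j then - M i j else 1ᴹ i j

  -- A basis of a P-matrix LCP is nonsingular, so x v is the vector B⁻¹ q for
  -- the basis B at v.
  record IsRealizable {n} (o : USO n) : Set (c ⊔ ℓ₁ ⊔ ℓ₂) where
    field
      M             : Matrix n
      q             : Vector Carrier n
      isPMatrix     : IsPMatrix M
      x             : Vertex n → Vector Carrier n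
      basic         : ∀ v i → (basis M v *ⱽ x v) i ≈ q i
      nondegenerate : ∀ v i → ¬ (x v i ≈ 0#)
      reduction     : ∀ v i → lookup (outmap o v) i ≡ true ⇔ x v i < 0#

-- Deterministic query algorithms on the n-cube: output a vertex, or evaluate a
-- vertex and continue depending on the answer.
data Algorithm (n : ℕ) : Set where
  output   : Vertex n → Algorithm n
  evaluate : Vertex n → (Vertex n → Algorithm n) → Algorithm n

result : ∀ {n} → Algorithm n → USO n → Vertex n
result (output v)     o = v
result (evaluate v k) o = result (k (outmap o v)) o

evaluations : ∀ {n} → Algorithm n → USO n → ℕ
evaluations (output v)     o = 0
evaluations (evaluate v k) o = suc (evaluations (k (outmap o v)) o)

{-# OPTIONS --safe #-}
-- Comparing the basic solutions of the LCP at the four vertices of a square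
-- face through the sink shows: if j influences k but not i, then i influences k
-- iff it influences j. Hence influence is the ancestor relation of a forest, and
-- the answer at v, xored with the answer at 0, holds at j the parity of v along
-- the path from the root to j.
--
-- Evaluating the set of nodes of depth divisible by 2ᵏ therefore yields the k-th
-- binary digits of all depths. Once these are known, the nearest proper ancestor
-- of depth divisible by 2ᵏ is found for decreasing k: strictly below the nearest
-- such ancestor for k + 1, the path to j has at most one node whose depth is an
-- odd multiple of 2ᵏ, so the parities of the log n code bits of such nodes spell
-- out this node. For k = 0 these are the parents, and the sink s satisfies
-- sⱼ = bⱼ ⊕ b_parent(j), where b is the answer at 0.

module Submission where

open import Algebra.Bundles using (CommutativeRing)
import Algebra.Properties.CommutativeSemigroup as CommutativeSemigroupProperties
import Algebra.Properties.Ring as RingProperties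
import Algebra.Properties.Semiring.Sum as Summation
import Algebra.Solver.Ring.NaturalCoefficients.Default as SemiringSolver
open import Data.Bool.Base using (Bool; true; false; not; _∧_; _xor_; if_then_else_)
import Data.Bool.Properties as Bool
open import Data.Empty using (⊥-elim)
open import Data.Fin.Base using (Fin; zero; suc; combine; finToFun; funToFin; inject≤)
open import Data.Fin.Properties using (_≟_; any?; all?; 2↔Bool; funToFin-finToFin; inject≤-injective)
open import Data.Fin.Subset using (∣_∣; ⁅_⁆; _∪_) renaming (_∈_ to _∈ₛ_)
open import Data.Fin.Subset.Properties using (∣p∣≤n; ∣⊥∣≡0; x∈p∪q⁺; x∈p∪q⁻; x∈⁅x⁆; x∈⁅y⁆⇒x≡y)
open import Data.List.Base using (List; []; _∷_; allFin)
open import Data.List.Membership.Propositional using (_∈_)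
open import Data.List.Membership.Propositional.Properties using (∈-allFin)
open import Data.List.Relation.Unary.Any using (here; there)
open import Data.Maybe.Base using (Maybe; just; nothing; maybe)
open import Data.Nat.Base using (ℕ; zero; suc; z<s; s≤s)
open import Data.Nat.Logarithm using (⌊log₂⌋-mono-≤; ⌊log₂[2^n]⌋≡n)
import Data.Nat.Properties as ℕ
import Data.Nat.Solver as ℕ
open import Data.Product.Base using (_,_; proj₁; proj₂)
open import Data.Sum.Base using (_⊎_; inj₁; inj₂; [_,_]′)
open import Data.Vec.Base using (Vec; []; _∷_; lookup; map; replicate; tabulate)
open import Data.Vec.Properties using
  ( lookup∘tabulate; lookup∘updateAt; lookup∘updateAt′; lookup-map; lookup-replicate
  ; lookup-zipWith; tabulate-cong; tabulate∘lookup )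
open import Function.Base using (_∘_)
open import Function.Bundles using (Equivalence; Injection; Inverse)
open import Function.Properties.Inverse using (↔⇒↣)
open import Relation.Binary.Definitions using (tri<; tri≈; tri>)
open import Relation.Binary.PropositionalEquality as ≡ using (_≡_; _≢_; _≗_)
open import Relation.Binary.Structures using (IsStrictTotalOrder)
open import Relation.Nullary using (¬_; Dec; yes; no)
open import Defs

-- Induction on the hypercube and elementary sums

cube-induction : ∀ {p n} (P : Vertex n → Set p) → P (replicate n false) →
  (∀ v i → P v → P (neighbour v i)) → ∀ v → P v
cube-induction P base step []      = base
cube-induction P base step (b ∷ v) = at b
  where
  at-false : P (false ∷ v)
  at-false = cube-induction (P ∘ (false ∷_)) base (λ w i → step (false ∷ w) (suc i)) v

  at : ∀ b → P (b ∷ v)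
  at false = at-false
  at true  = step (false ∷ v) zero at-false

lookup-neighbour : ∀ {n} (v : Vertex n) i → lookup (neighbour v i) i ≡ not (lookup v i)
lookup-neighbour v i = lookup∘updateAt i v

lookup-neighbour′ : ∀ {n} (v : Vertex n) {i j} → j ≢ i →
  lookup (neighbour v i) j ≡ lookup v j
lookup-neighbour′ v {i} {j} j≢i = lookup∘updateAt′ j i j≢i v

module _ {c ℓ} (R : CommutativeRing c ℓ) where

  open CommutativeRing R hiding (zero)
  open LinearAlgebra R
  open Summation semiring

  sum-zero : ∀ {n} (f : Fin n → Carrier) → (∀ j → f j ≈ 0#) → sum f ≈ 0#
  sum-zero {n} f f≈0 = trans (sum-cong-≋ {n} {f} {λ _ → 0#} f≈0) (sum-replicate-zero n)

  sum-1ᴹ : ∀ {n} (i : Fin n) (f : Fin n → Carrier) → sum (λ j → 1ᴹ i j * f j) ≈ f i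
  sum-1ᴹ zero    f = trans
    (+-cong (*-identityˡ _) (sum-zero (λ j → 0# * f (suc j)) (λ j → zeroˡ _)))
    (+-identityʳ _)
  sum-1ᴹ (suc i) f = trans (+-cong (zeroˡ _) (sum-1ᴹ i (f ∘ suc))) (+-identityˡ _)

-- Signs in an ordered field

module _ {c ℓ₁ ℓ₂} (K : OrderedField c ℓ₁ ℓ₂) where

  open OrderedField K hiding (zero)
  open RingProperties ring
  open IsStrictTotalOrder isStrictTotalOrder using (compare; irrefl; <-respʳ-≈; <-respˡ-≈)
    renaming (trans to <-trans)
  open SemiringSolver commutativeSemiring using (solve; _:=_; _:+_; _:*_; con)

  *-zero-divisor : ∀ {x y} → ¬ (x ≈ 0#) → x * y ≈ 0# → y ≈ 0#
  *-zero-divisor {x} {y} x≉0 xy≈0 with z , xz≈1 ← inverse x x≉0 = begin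
    y           ≈⟨ *-identityˡ y ⟨
    1# * y      ≈⟨ *-congʳ xz≈1 ⟨
    (x * z) * y ≈⟨ solve 3 (λ x z y → (x :* z) :* y := z :* (x :* y)) refl x z y ⟩
    z * (x * y) ≈⟨ *-congˡ xy≈0 ⟩
    z * 0#      ≈⟨ zeroʳ z ⟩
    0#          ∎
    where open import Relation.Binary.Reasoning.Setoid setoid

  signed : Bool → Carrier → Carrier
  signed false x = x
  signed true  x = - x

  -- The Boolean plays the role of an outmap bit: `true` means negative, so signs of products
  -- combine by `xor`.
  Sgn : Bool → Carrier → Set ℓ₂
  Sgn b x = 0# < signed b x

  signed-* : ∀ a b x y → signed a x * signed b y ≈ signed (a xor b) (x * y)
  signed-* false false x y = refl
  signed-* false true  x y = sym (-‿distribʳ-* x y)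
  signed-* true  false x y = sym (-‿distribˡ-* x y)
  signed-* true  true  x y = trans (sym (-‿distribˡ-* x (- y)))
    (trans (-‿cong (sym (-‿distribʳ-* x y))) (-‿involutive (x * y)))

  Sgn-* : ∀ a b {x y} → Sgn a x → Sgn b y → Sgn (a xor b) (x * y)
  Sgn-* a b 0<x 0<y = <-respʳ-≈ (signed-* a b _ _) (*-pos 0<x 0<y)

  Sgn-neg : ∀ b {x} → Sgn b x → Sgn (not b) (- x)
  Sgn-neg false 0<x = <-respʳ-≈ (sym (-‿involutive _)) 0<x
  Sgn-neg true  0<x = 0<x

  signed-+ : ∀ b x y → signed b x + signed b y ≈ signed b (x + y)
  signed-+ false x y = refl
  signed-+ true  x y = -‿+-comm x y

  Sgn-+ : ∀ b {x y} → Sgn b x → Sgn b y → Sgn b (x + y)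
  Sgn-+ b {x} {y} 0<x 0<y = <-respʳ-≈ (signed-+ b x y)
    (<-trans 0<y (<-respˡ-≈ (+-identityˡ _) (+-monoˡ-< _ 0<x)))

  Sgn⇒≉0 : ∀ b {x} → Sgn b x → ¬ (x ≈ 0#)
  Sgn⇒≉0 false 0<x x≈0 = irrefl (sym x≈0) 0<x
  Sgn⇒≉0 true  0<x x≈0 = irrefl (sym (trans (-‿cong x≈0) -0#≈0#)) 0<x

  -- Basic solutions of the LCP and the signs on a square face

  module _ {n} {o : USO n} (realizable : IsRealizable K o) where

    open IsRealizable realizable
    open LinearAlgebra commutativeRing
    open Summation semiring
    open import Relation.Binary.Reasoning.Setoid setoid

    -- Nondegeneracy excludes 0, so an outmap bit `false` yields a strictly positive entry.
    Sgn-reduction : ∀ v i → Sgn (lookup (outmap o v) i) (x v i)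
    Sgn-reduction v i with lookup (outmap o v) i in eq
    ... | true  = <-respˡ-≈ (-‿inverseʳ (x v i))
          (<-respʳ-≈ (+-identityˡ _) (+-monoˡ-< _ (Equivalence.to (reduction v i) eq)))
    ... | false with compare (x v i) 0#
    ...   | tri< x<0 _ _ with () ← ≡.trans (≡.sym eq) (Equivalence.from (reduction v i) x<0)
    ...   | tri≈ _ x≈0 _ = ⊥-elim (nondegenerate v i x≈0)
    ...   | tri> _ _ x>0 = x>0

    -- u j false and u j true are the values of w j and z j.
    Assignment : Set c
    Assignment = Fin n → Bool → Carrier

    column : Fin n → Fin n → Bool → Carrier
    column r j b = if b then - M r j else 1ᴹ r j

    residualTerm : Assignment → Fin n → Fin n → Carrier
    residualTerm u r j = column r j false * u j false + column r j true * u j true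

    -- Row `r` of `w - M z`; the right-hand side `q` is not subtracted.
    residual : Assignment → Fin n → Carrier
    residual u r = sum (residualTerm u r)

    -- Scaling the right-hand side by `a` makes solutions closed under linear combinations; those
    -- with `a = 0` form the kernel.
    record Solves (u : Assignment) (a : Carrier) : Set ℓ₁ where
      constructor solves
      field residual≈ : ∀ r → residual u r ≈ a * q r

    open Solves

    Solves-+ : ∀ {u u′ a a′} → Solves u a → Solves u′ a′ →
      Solves (λ j b → u j b + u′ j b) (a + a′)
    Solves-+ {u} {u′} {a} {a′} (solves h) (solves h′) = solves λ r → begin
      residual (λ j b → u j b + u′ j b) r
        ≈⟨ sum-cong-≋ (λ j → solve 6 (λ c d x y x′ y′ →
             c :* (x :+ x′) :+ d :* (y :+ y′) := (c :* x :+ d :* y) :+ (c :* x′ :+ d :* y′))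
             refl (column r j false) (column r j true)
             (u j false) (u j true) (u′ j false) (u′ j true)) ⟩
      sum (λ j → residualTerm u r j + residualTerm u′ r j)
        ≈⟨ ∑-distrib-+ (residualTerm u r) _ ⟩
      residual u r + residual u′ r ≈⟨ +-cong (h r) (h′ r) ⟩
      a * q r + a′ * q r           ≈⟨ distribʳ _ _ _ ⟨
      (a + a′) * q r               ∎

    Solves-* : ∀ {u a} d → Solves u a → Solves (λ j b → d * u j b) (d * a)
    Solves-* {u} {a} d (solves h) = solves λ r → begin
      residual (λ j b → d * u j b) r
        ≈⟨ sum-cong-≋ (λ j → solve 5 (λ d e f x y →
             e :* (d :* x) :+ f :* (d :* y) := d :* (e :* x :+ f :* y))
             refl d (column r j false) (column r j true) (u j false) (u j true)) ⟩
      sum (λ j → d * residualTerm u r j)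
        ≈⟨ *-distribˡ-sum d (residualTerm u r) ⟨
      d * residual u r ≈⟨ *-congˡ (h r) ⟩
      d * (a * q r)    ≈⟨ *-assoc d a (q r) ⟨
      d * a * q r      ∎

    Solves-resp : ∀ {u a a′} → a ≈ a′ → Solves u a → Solves u a′
    Solves-resp a≈a′ (solves h) = solves λ r → trans (h r) (*-congʳ a≈a′)

    solution : Vertex n → Assignment
    solution v j b = if lookup v j xor b then 0# else x v j

    solution-basic : ∀ v {j b} → b ≡ lookup v j → solution v j b ≈ x v j
    solution-basic v {j} ≡.refl rewrite Bool.xor-same (lookup v j) = refl

    solution-nonbasic : ∀ v {j b} → b ≡ not (lookup v j) → solution v j b ≈ 0#
    solution-nonbasic v {j} ≡.refl with lookup v j
    ... | false = refl
    ... | true  = refl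

    solution-solves : ∀ v → Solves (solution v) 1#
    solution-solves v = solves λ r → begin
      residual (solution v) r ≈⟨ sum-cong-≋ (term r) ⟩
      (basis K M v *ⱽ x v) r  ≈⟨ basic v r ⟩
      q r                     ≈⟨ *-identityˡ _ ⟨
      1# * q r                ∎
      where
      term : ∀ r j → residualTerm (solution v) r j ≈ basis K M v r j * x v j
      term r j with lookup v j
      ... | false = trans (+-congˡ (zeroʳ _)) (+-identityʳ _)
      ... | true  = trans (+-congʳ (zeroʳ _)) (+-identityˡ _)

    -- Linear independence of the columns of the basis at `v`, in terms of assignments supported on
    -- the basic variables.
    Independent : Vertex n → Set _
    Independent v = ∀ u → (∀ j {b} → b ≡ not (lookup v j) → u j b ≈ 0#) → Solves u 0# →
      ∀ j {b} → b ≡ lookup v j → u j b ≈ 0#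

    -- The basis at 0 is the identity matrix, so the residual reads off the `w` variables.
    independent-base : Independent (replicate n false)
    independent-base u nonbasic h j {b} eq rewrite ≡.trans eq (lookup-replicate j false) = begin
      u j false                      ≈⟨ sum-1ᴹ commutativeRing j (λ i → u i false) ⟨
      sum (λ i → 1ᴹ j i * u i false) ≈⟨ sum-cong-≋ (λ i →
        trans (+-congˡ (trans (*-congˡ (z-zero i)) (zeroʳ _))) (+-identityʳ _)) ⟨
      residual u j                   ≈⟨ residual≈ h j ⟩
      0# * q j                       ≈⟨ zeroˡ _ ⟩
      0#                             ∎
      where
      z-zero : ∀ i → u i true ≈ 0#
      z-zero i = nonbasic i (≡.cong not (≡.sym (lookup-replicate i false)))

    -- A basis exchange. Adding a multiple of `X - X′` to a kernel element supported on the basis at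
    -- `v′` moves its support to the basis at `v`, where independence is known.
    independent-step : ∀ v i → Independent v → Independent (neighbour v i)
    independent-step v i ind u nonbasic h = u-zero
      where
      v′ = neighbour v i
      X  = solution v
      X′ = solution v′
      a  = u i (lookup v′ i)

      y : Assignment
      -- The factor `x v′ i` avoids a division; the multiple of `X - X′` cancels variable `i` of the
      -- basis at `v′`.
      y j b = x v′ i * u j b + (a * X j b + (- a) * X′ j b)

      y-solves : Solves y 0#
      y-solves = Solves-resp
        (trans (+-cong (zeroʳ _) (trans (+-cong (*-identityʳ a) (*-identityʳ (- a))) (-‿inverseʳ a)))
          (+-identityʳ _))
        (Solves-+ (Solves-* _ h)
          (Solves-+ (Solves-* _ (solution-solves v)) (Solves-* _ (solution-solves v′))))

      y-nonbasic : ∀ j {b} → b ≡ not (lookup v j) → y j b ≈ 0#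
      y-nonbasic j {b} eq with j ≟ i
      ... | yes ≡.refl = begin
        x v′ i * u i b + (a * X i b + (- a) * X′ i b)
          ≈⟨ +-cong (*-congˡ (reflexive (≡.cong (u i) eq′)))
               (+-cong (*-congˡ (solution-nonbasic v eq)) (*-congˡ (solution-basic v′ eq′))) ⟩
        x v′ i * a + (a * 0# + (- a) * x v′ i)
          ≈⟨ solve 3 (λ x a m → x :* a :+ (a :* con 0 :+ m :* x) := (a :+ m) :* x) refl (x v′ i) a (- a) ⟩
        (a + - a) * x v′ i ≈⟨ *-congʳ (-‿inverseʳ a) ⟩
        0# * x v′ i        ≈⟨ zeroˡ _ ⟩
        0#                 ∎
        where
        eq′ : b ≡ lookup v′ i
        eq′ = ≡.trans eq (≡.sym (lookup-neighbour v i))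
      ... | no j≢i = begin
        x v′ i * u j b + (a * X j b + (- a) * X′ j b)
          ≈⟨ +-cong (*-congˡ (nonbasic j eq′))
               (+-cong (*-congˡ (solution-nonbasic v eq)) (*-congˡ (solution-nonbasic v′ eq′))) ⟩
        x v′ i * 0# + (a * 0# + (- a) * 0#)
          ≈⟨ solve 3 (λ x a m → x :* con 0 :+ (a :* con 0 :+ m :* con 0) := con 0) refl (x v′ i) a (- a) ⟩
        0# ∎
        where
        eq′ : b ≡ not (lookup v′ j)
        eq′ = ≡.trans eq (≡.cong not (≡.sym (lookup-neighbour′ v j≢i)))

      y-zero : ∀ j {b} → b ≡ lookup v j → y j b ≈ 0#
      y-zero = ind y y-nonbasic y-solves

      -- At the variable of `i` that is basic at `v`, both `u` and `X′` vanish, so only `a * x v i`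
      -- remains of `y`.
      a-zero : a ≈ 0#
      a-zero = *-zero-divisor (nondegenerate v i) (begin
        x v i * a
          ≈⟨ solve 4 (λ x x′ a m → x :* a := x′ :* con 0 :+ (a :* x :+ m :* con 0))
               refl (x v i) (x v′ i) a (- a) ⟩
        x v′ i * 0# + (a * x v i + (- a) * 0#)
          ≈⟨ +-cong (*-congˡ (nonbasic i eq))
               (+-cong (*-congˡ (solution-basic v ≡.refl)) (*-congˡ (solution-nonbasic v′ eq))) ⟨
        y i (lookup v i) ≈⟨ y-zero i ≡.refl ⟩
        0#               ∎)
        where
        eq : lookup v i ≡ not (lookup v′ i)
        eq = ≡.trans (≡.sym (Bool.not-involutive _)) (≡.cong not (≡.sym (lookup-neighbour v i)))

      u-zero : ∀ j {b} → b ≡ lookup v′ j → u j b ≈ 0#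
      u-zero j {b} eq with j ≟ i
      ... | yes ≡.refl = trans (reflexive (≡.cong (u i) eq)) a-zero
      ... | no j≢i = *-zero-divisor (nondegenerate v′ i) (begin
        x v′ i * u j b
          ≈⟨ solve 4 (λ t p X X′ → t :* p := t :* p :+ (con 0 :* X :+ con 0 :* X′))
               refl (x v′ i) (u j b) (X j b) (X′ j b) ⟩
        x v′ i * u j b + (0# * X j b + 0# * X′ j b)
          ≈⟨ +-congˡ (+-cong (*-congʳ a-zero) (*-congʳ (trans (-‿cong a-zero) -0#≈0#))) ⟨
        y j b
          ≈⟨ y-zero j (≡.trans eq (lookup-neighbour′ v j≢i)) ⟩
        0# ∎)

    independent : ∀ v → Independent v
    independent = cube-induction Independent independent-base independent-step

    -- The combination of the solutions at v, v ⊕ eᵢ, v ⊕ eⱼ and v ⊕ eᵢ ⊕ eⱼ in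
    -- which both nonbasic variables of v cancel vanishes, since the columns of
    -- the basis at v are independent; eliminating the coefficient of x v between
    -- its i-th and k-th entries gives this identity.
    square-identity : ∀ v {i j k} → i ≢ j → k ≢ i → k ≢ j →
      let v₁ = neighbour v i
          v₂ = neighbour v j
          v₁₂ = neighbour v₁ j
      in x v i * ((x v₁ i * x v₂ j) * x v₁₂ k
                   + (- (x v₂ j * x v₁₂ i) * x v₁ k + - (x v₁ i * x v₁₂ j) * x v₂ k))
           + ((x v₁ i * x v₁₂ j) * x v₂ i) * x v k ≈ 0#
    square-identity v {i} {j} {k} i≢j k≢i k≢j = begin
      x v i * (t * x v₁₂ k + (p * x v₁ k + m * x v₂ k)) + (r * x v₂ i) * x v k
        -- To eliminate `g`, a vanishing multiple of `entry-i` is added. The semiring solver treats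
        -- `m = - r` as an atom, so `r + m` is cancelled separately.
        ≈⟨ trans (+-congˡ (trans (*-congˡ entry-i) (zeroʳ _))) (+-identityʳ _) ⟨
      (x v i * (t * x v₁₂ k + (p * x v₁ k + m * x v₂ k)) + (r * x v₂ i) * x v k)
        + x v k * (m * x v₂ i + g * x v i)
        ≈⟨ solve 11 (λ r m p t g A B b d e f →
             (A :* (t :* d :+ (p :* e :+ m :* f)) :+ (r :* b) :* B) :+ B :* (m :* b :+ g :* A)
             := A :* (t :* d :+ (p :* e :+ (m :* f :+ g :* B))) :+ (r :+ m) :* (b :* B))
             refl r m p t g (x v i) (x v k) (x v₂ i) (x v₁₂ k) (x v₁ k) (x v₂ k) ⟩
      x v i * (t * x v₁₂ k + (p * x v₁ k + (m * x v₂ k + g * x v k))) + (r + m) * (x v₂ i * x v k)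
        ≈⟨ +-cong (trans (*-congˡ entry-k) (zeroʳ _)) (trans (*-congʳ (-‿inverseʳ r)) (zeroˡ _)) ⟩
      0# + 0# ≈⟨ +-identityʳ 0# ⟩
      0#      ∎
      where
      v₁  = neighbour v i
      v₂  = neighbour v j
      v₁₂ = neighbour v₁ j
      -- `p` cancels the flipped variable `i` against `v₁₂`, `m` the flipped variable `j`, and `g`
      -- makes the four coefficients sum to 0, so that the right-hand side vanishes.
      t = x v₁ i * x v₂ j
      p = - (x v₂ j * x v₁₂ i)
      r = x v₁ i * x v₁₂ j
      m = - r
      g = (x v₂ j * x v₁₂ i + r) + - t
      X   = solution v
      X₁  = solution v₁
      X₂  = solution v₂
      X₁₂ = solution v₁₂

      y : Assignment
      y l b = t * X₁₂ l b + (p * X₁ l b + (m * X₂ l b + g * X l b))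

      y-cong : ∀ l {b c₁₂ c₁ c₂ c₀} → X₁₂ l b ≈ c₁₂ → X₁ l b ≈ c₁ → X₂ l b ≈ c₂ → X l b ≈ c₀ →
        y l b ≈ t * c₁₂ + (p * c₁ + (m * c₂ + g * c₀))
      y-cong l e₁₂ e₁ e₂ e₀ =
        +-cong (*-congˡ e₁₂) (+-cong (*-congˡ e₁) (+-cong (*-congˡ e₂) (*-congˡ e₀)))

      y-solves : Solves y 0#
      y-solves = Solves-resp (begin
          t * 1# + (p * 1# + (m * 1# + g * 1#))
            ≈⟨ solve 6 (λ t p m P r n → t :* con 1 :+ (p :* con 1 :+ (m :* con 1 :+ ((P :+ r) :+ n) :* con 1))
                 := ((t :+ n) :+ (P :+ p)) :+ (r :+ m)) refl t p m (x v₂ j * x v₁₂ i) r (- t) ⟩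
          ((t + - t) + (x v₂ j * x v₁₂ i + p)) + (r + m)
            ≈⟨ +-cong (+-cong (-‿inverseʳ _) (-‿inverseʳ _)) (-‿inverseʳ _) ⟩
          (0# + 0#) + 0# ≈⟨ trans (+-identityʳ _) (+-identityʳ _) ⟩
          0# ∎)
        (Solves-+ (Solves-* t (solution-solves v₁₂)) (Solves-+ (Solves-* p (solution-solves v₁))
          (Solves-+ (Solves-* m (solution-solves v₂)) (Solves-* g (solution-solves v)))))

      v₁₂-at-i : lookup v₁₂ i ≡ not (lookup v i)
      v₁₂-at-i = ≡.trans (lookup-neighbour′ v₁ i≢j) (lookup-neighbour v i)

      v₁₂-at-j : lookup v₁₂ j ≡ not (lookup v j)
      v₁₂-at-j = ≡.trans (lookup-neighbour v₁ j) (≡.cong not (lookup-neighbour′ v (i≢j ∘ ≡.sym)))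

      v₁₂-elsewhere : ∀ {l} → l ≢ i → l ≢ j → lookup v₁₂ l ≡ lookup v l
      v₁₂-elsewhere l≢i l≢j = ≡.trans (lookup-neighbour′ v₁ l≢j) (lookup-neighbour′ v l≢i)

      y-nonbasic : ∀ l {b} → b ≡ not (lookup v l) → y l b ≈ 0#
      y-nonbasic l {b} eq with l ≟ i
      ... | yes ≡.refl = begin
        y i b ≈⟨ y-cong i (solution-basic v₁₂ (≡.trans eq (≡.sym v₁₂-at-i)))
                   (solution-basic v₁ (≡.trans eq (≡.sym (lookup-neighbour v i))))
                   (solution-nonbasic v₂ (≡.trans eq (≡.cong not (≡.sym (lookup-neighbour′ v i≢j)))))
                   (solution-nonbasic v eq) ⟩
        t * x v₁₂ i + (p * x v₁ i + (m * 0# + g * 0#))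
          ≈⟨ solve 6 (λ a b c p m g → (a :* b) :* c :+ (p :* a :+ (m :* con 0 :+ g :* con 0))
               := (b :* c :+ p) :* a) refl (x v₁ i) (x v₂ j) (x v₁₂ i) p m g ⟩
        (x v₂ j * x v₁₂ i + p) * x v₁ i ≈⟨ trans (*-congʳ (-‿inverseʳ _)) (zeroˡ _) ⟩
        0# ∎
      ... | no l≢i with l ≟ j
      ...   | yes ≡.refl = begin
        y j b ≈⟨ y-cong j (solution-basic v₁₂ (≡.trans eq (≡.sym v₁₂-at-j)))
                   (solution-nonbasic v₁ (≡.trans eq (≡.cong not (≡.sym (lookup-neighbour′ v l≢i)))))
                   (solution-basic v₂ (≡.trans eq (≡.sym (lookup-neighbour v j))))
                   (solution-nonbasic v eq) ⟩
        t * x v₁₂ j + (p * 0# + (m * x v₂ j + g * 0#))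
          ≈⟨ solve 6 (λ a b c p m g → (a :* b) :* c :+ (p :* con 0 :+ (m :* b :+ g :* con 0))
               := (a :* c :+ m) :* b) refl (x v₁ i) (x v₂ j) (x v₁₂ j) p m g ⟩
        (x v₁ i * x v₁₂ j + m) * x v₂ j ≈⟨ trans (*-congʳ (-‿inverseʳ _)) (zeroˡ _) ⟩
        0# ∎
      ...   | no l≢j = begin
        y l b ≈⟨ y-cong l (solution-nonbasic v₁₂ (≡.trans eq (≡.cong not (≡.sym (v₁₂-elsewhere l≢i l≢j)))))
                   (solution-nonbasic v₁ (≡.trans eq (≡.cong not (≡.sym (lookup-neighbour′ v l≢i)))))
                   (solution-nonbasic v₂ (≡.trans eq (≡.cong not (≡.sym (lookup-neighbour′ v l≢j)))))
                   (solution-nonbasic v eq) ⟩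
        t * 0# + (p * 0# + (m * 0# + g * 0#))
          ≈⟨ solve 4 (λ t p m g → t :* con 0 :+ (p :* con 0 :+ (m :* con 0 :+ g :* con 0)) := con 0)
               refl t p m g ⟩
        0# ∎

      y-zero : ∀ l → y l (lookup v l) ≈ 0#
      y-zero l = independent v y y-nonbasic y-solves l ≡.refl

      entry-i : m * x v₂ i + g * x v i ≈ 0#
      entry-i = begin
        m * x v₂ i + g * x v i
          ≈⟨ solve 6 (λ t p m g a b → t :* con 0 :+ (p :* con 0 :+ (m :* a :+ g :* b)) := m :* a :+ g :* b)
               refl t p m g (x v₂ i) (x v i) ⟨
        t * 0# + (p * 0# + (m * x v₂ i + g * x v i))
          ≈⟨ y-cong i
               (solution-nonbasic v₁₂ (≡.trans (≡.sym (Bool.not-involutive _)) (≡.cong not (≡.sym v₁₂-at-i))))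
               (solution-nonbasic v₁ (≡.trans (≡.sym (Bool.not-involutive _)) (≡.cong not (≡.sym (lookup-neighbour v i)))))
               (solution-basic v₂ (≡.sym (lookup-neighbour′ v i≢j)))
               (solution-basic v ≡.refl) ⟨
        y i (lookup v i) ≈⟨ y-zero i ⟩
        0#               ∎

      entry-k : t * x v₁₂ k + (p * x v₁ k + (m * x v₂ k + g * x v k)) ≈ 0#
      entry-k = trans (sym (y-cong k
          (solution-basic v₁₂ (≡.sym (v₁₂-elsewhere k≢i k≢j)))
          (solution-basic v₁ (≡.sym (lookup-neighbour′ v k≢i)))
          (solution-basic v₂ (≡.sym (lookup-neighbour′ v k≢j)))
          (solution-basic v ≡.refl)))
        (y-zero k)

    module _ (N : Fin n → Fin n → Bool)
             (outmap-neighbour : ∀ v i k → lookup (outmap o (neighbour v i)) k ≡ lookup (outmap o v) k xor N k i)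
             (N-refl : ∀ i → N i i ≡ true)
             {s} (sink : IsSink o s) where

      -- If `N k i` and `N j i` differed, all outmap bits on the square at the sink would be
      -- determined up to `b`, and every summand of `square-identity` would have the sign `not b`;
      -- such a sum cannot be 0.
      influence-agree : ∀ {i j k} → N k j ≡ true → N i j ≡ false → N k i ≡ N j i
      influence-agree {i} {j} {k} Nkj Nij with k ≟ j | N k i Bool.≟ N j i
      ... | yes ≡.refl | _      = ≡.refl
      ... | no _       | yes eq = eq
      ... | no k≢j     | no neq = ⊥-elim (Sgn⇒≉0 (not b)
          (Sgn-+ (not b)
            (Sgn-* false (not b) (xₛ>0 i)
              (Sgn-+ (not b)
                (Sgn-* false (not b) (Sgn-* true true x₁i x₂j) x₁₂k)
                (Sgn-+ (not b)
                  (Sgn-* true b (Sgn-neg false (Sgn-* true true x₂j x₁₂i)) x₁k)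
                  (recast (≡.trans (Bool.xor-comm _ true) (≡.cong not (Bool.not-involutive b)))
                    (Sgn-* (not (not b)) true (Sgn-neg (not b) x₁i*x₁₂j) x₂k)))))
            (recast (≡.trans (Bool.xor-identityʳ _) (Bool.xor-identityʳ (not b)))
              (Sgn-* (not b xor false) false (Sgn-* (not b) false x₁i*x₁₂j x₂i) (xₛ>0 k))))
          (square-identity s i≢j k≢i k≢j))
        where
        b  = N k i
        v₁ = neighbour s i
        v₂ = neighbour s j
        v₁₂ = neighbour v₁ j

        i≢j : i ≢ j
        i≢j ≡.refl with () ← ≡.trans (≡.sym Nij) (N-refl i)

        k≢i : k ≢ i
        k≢i ≡.refl with () ← ≡.trans (≡.sym Nij) Nkj

        recast : ∀ {a b x} → a ≡ b → Sgn a x → Sgn b x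
        recast ≡.refl h = h

        sgn : ∀ v l {b} → lookup (outmap o v) l ≡ b → Sgn b (x v l)
        sgn v l eq = recast eq (Sgn-reduction v l)

        o₁ : ∀ i l → lookup (outmap o (neighbour s i)) l ≡ N l i
        o₁ i l = ≡.trans (outmap-neighbour s i l) (≡.cong (_xor N l i) (sink l))

        o₁₂ : ∀ l → lookup (outmap o v₁₂) l ≡ N l i xor N l j
        o₁₂ l = ≡.trans (outmap-neighbour v₁ j l) (≡.cong (_xor N l j) (o₁ i l))

        Nji : N j i ≡ not b
        Nji = Bool.¬-not (neq ∘ ≡.sym)

        xₛ>0 : ∀ l → Sgn false (x s l)
        xₛ>0 l = sgn s l (sink l)

        x₁i : Sgn true (x v₁ i)
        x₁i = sgn v₁ i (≡.trans (o₁ i i) (N-refl i))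

        x₁k : Sgn b (x v₁ k)
        x₁k = sgn v₁ k (o₁ i k)

        x₂i : Sgn false (x v₂ i)
        x₂i = sgn v₂ i (≡.trans (o₁ j i) Nij)

        x₂j : Sgn true (x v₂ j)
        x₂j = sgn v₂ j (≡.trans (o₁ j j) (N-refl j))

        x₂k : Sgn true (x v₂ k)
        x₂k = sgn v₂ k (≡.trans (o₁ j k) Nkj)

        x₁₂i : Sgn true (x v₁₂ i)
        x₁₂i = sgn v₁₂ i (≡.trans (o₁₂ i) (≡.cong₂ _xor_ (N-refl i) Nij))

        x₁₂k : Sgn (not b) (x v₁₂ k)
        x₁₂k = sgn v₁₂ k (≡.trans (o₁₂ k) (≡.trans (≡.cong (b xor_) Nkj) (Bool.xor-comm b true)))

        x₁i*x₁₂j : Sgn (not b) (x v₁ i * x v₁₂ j)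
        x₁i*x₁₂j = Sgn-* true b x₁i (sgn v₁₂ j (≡.trans (o₁₂ j)
          (≡.trans (≡.cong₂ _xor_ Nji (N-refl j)) (≡.trans (Bool.xor-comm (not b) true) (Bool.not-involutive b)))))

-- Matoušek-type outmaps and their influence matrix

open ≡ using (refl; sym; trans; cong; cong₂; subst; module ≡-Reasoning)
open import Data.Nat.Base using (ℕ; _*_; _^_; _≤_)
open import Data.Nat.Base using (_+_; _<_)
open import Data.Nat.Logarithm using (⌊log₂_⌋)
open import Data.Product.Base using (Σ-syntax; ∃-syntax; _×_)
open CommutativeSemigroupProperties
  (CommutativeRing.+-commutativeSemigroup Bool.xor-∧-commutativeRing)
  using (interchange; xy∙z≈xz∙y)

vertex-ext : ∀ {n} {u v : Vertex n} → (∀ i → lookup u i ≡ lookup v i) → u ≡ v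
vertex-ext {u = u} {v} eq =
  trans (sym (tabulate∘lookup u)) (trans (tabulate-cong eq) (tabulate∘lookup v))

xor-cancelˡ : ∀ x y → x xor (x xor y) ≡ y
xor-cancelˡ x y = trans (sym (Bool.xor-assoc x x y)) (cong (_xor y) (Bool.xor-same x))

xor-cancelʳ : ∀ x y → (x xor y) xor y ≡ x
xor-cancelʳ x y = trans (Bool.xor-assoc x y y)
  (trans (cong (x xor_) (Bool.xor-same y)) (Bool.xor-identityʳ x))

lookup-neighbour-xor : ∀ {n} (v : Vertex n) i j →
  lookup (neighbour v i) j ≡ lookup v j xor GF2.1ᴹ j i
lookup-neighbour-xor v i j with j ≟ i
... | yes refl = trans (lookup-neighbour v i) (Bool.xor-comm true _)
... | no j≢i   = trans (lookup-neighbour′ v j≢i) (sym (Bool.xor-identityʳ _))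

1ᴹ-sym : ∀ {n} (i j : Fin n) → GF2.1ᴹ i j ≡ GF2.1ᴹ j i
1ᴹ-sym i j with i ≟ j | j ≟ i
... | yes _    | yes _  = refl
... | no _     | no _   = refl
... | yes refl | no neq = ⊥-elim (neq refl)
... | no neq   | yes refl = ⊥-elim (neq refl)

module _ {n} {o : USO n} (matoušek : IsMatoušekType o) where

  open IsMatoušekType matoušek
  open CommutativeRing Bool.xor-∧-commutativeRing using (semiring)
  open Summation semiring

  -- The outmap is affine over GF(2), so a flip of coordinate `i` adds column `i` of `M`.
  outmap-neighbour : ∀ v i k →
    lookup (outmap o (neighbour v i)) k ≡ lookup (outmap o v) k xor M k i
  outmap-neighbour v i k = begin
    lookup (outmap o (neighbour v i)) k
      ≡⟨ outmap-at (neighbour v i) ⟩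
    sum (λ l → M k l ∧ lookup (neighbour v i ⊕ s) l)
      ≡⟨ sum-cong-≗ term ⟩
    sum (λ l → M k l ∧ lookup (v ⊕ s) l xor GF2.1ᴹ i l ∧ M k l)
      ≡⟨ ∑-distrib-+ (λ l → M k l ∧ lookup (v ⊕ s) l) _ ⟩
    sum (λ l → M k l ∧ lookup (v ⊕ s) l) xor sum (λ l → GF2.1ᴹ i l ∧ M k l)
      ≡⟨ cong₂ _xor_ (sym (outmap-at v)) (sum-1ᴹ Bool.xor-∧-commutativeRing i (M k)) ⟩
    lookup (outmap o v) k xor M k i ∎
    where
    open ≡-Reasoning

    outmap-at : ∀ v → lookup (outmap o v) k ≡ sum (λ l → M k l ∧ lookup (v ⊕ s) l)
    outmap-at v = trans (cong (λ u → lookup u k) (outmap-eq v)) (lookup∘tabulate _ k)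

    term : ∀ l → M k l ∧ lookup (neighbour v i ⊕ s) l ≡ M k l ∧ lookup (v ⊕ s) l xor GF2.1ᴹ i l ∧ M k l
    term l = begin
      M k l ∧ lookup (neighbour v i ⊕ s) l
        ≡⟨ cong (M k l ∧_) (lookup-zipWith _xor_ l (neighbour v i) s) ⟩
      M k l ∧ (lookup (neighbour v i) l xor lookup s l)
        ≡⟨ cong (λ b → M k l ∧ (b xor lookup s l)) (lookup-neighbour-xor v i l) ⟩
      M k l ∧ ((lookup v l xor GF2.1ᴹ l i) xor lookup s l)
        ≡⟨ cong (M k l ∧_) (xy∙z≈xz∙y (lookup v l) (GF2.1ᴹ l i) (lookup s l)) ⟩
      M k l ∧ ((lookup v l xor lookup s l) xor GF2.1ᴹ l i)
        ≡⟨ Bool.∧-distribˡ-xor (M k l) _ _ ⟩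
      M k l ∧ (lookup v l xor lookup s l) xor M k l ∧ GF2.1ᴹ l i
        ≡⟨ cong₂ _xor_ (cong (M k l ∧_) (sym (lookup-zipWith _xor_ l v s)))
             (trans (Bool.∧-comm (M k l) _) (cong (_∧ M k l) (1ᴹ-sym l i))) ⟩
      M k l ∧ lookup (v ⊕ s) l xor GF2.1ᴹ i l ∧ M k l ∎

  isSink : IsSink o s
  isSink i = trans (cong (λ u → lookup u i) (outmap-eq s)) (trans (lookup∘tabulate _ i)
    (sum-zero Bool.xor-∧-commutativeRing _ λ l →
      trans (cong (M i l ∧_) (trans (lookup-zipWith _xor_ l s s) (Bool.xor-same (lookup s l)))) (Bool.∧-zeroʳ _)))

-- (i , j) is an edge of the influence graph iff N j i ≡ true. Transitivity and
-- the comparability of two ancestors of k are both instances of N-agree.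
record BranchingInfluence {n} (o : USO n) : Set where
  field
    N                : Fin n → Fin n → Bool
    N-outmap : ∀ v i k →
      lookup (outmap o (neighbour v i)) k ≡ lookup (outmap o v) k xor N k i
    N-refl           : ∀ i → N i i ≡ true
    N-antisym        : ∀ {i j} → i ≢ j → N j i ≡ true → N i j ≡ false
    N-agree          : ∀ {i j k} → N k j ≡ true → N i j ≡ false → N k i ≡ N j i

module _ {c ℓ₁ ℓ₂} (K : OrderedField c ℓ₁ ℓ₂) {n} {o : USO n}
         (matoušek : IsMatoušekType o) (realizable : IsRealizable K o) where

  open IsMatoušekType matoušek

  private
    -- Both ends of an edge in direction `i` must disagree on its orientation, which a zero diagonal
    -- entry would prevent.
    influence-refl : ∀ i → M i i ≡ true
    influence-refl i with M i i in Mii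
    ... | true  = refl
    ... | false = ⊥-elim (consistent o s i (sym (trans (outmap-neighbour matoušek s i i)
                    (trans (cong (lookup (outmap o s) i xor_) Mii) (Bool.xor-identityʳ _)))))

    -- With mutual influence, the square through `s` in directions `i` and `j` would have two sinks:
    -- `s` and its antipode `t`.
    influence-antisym : ∀ {i j} → i ≢ j → M j i ≡ true → M i j ≡ false
    influence-antisym {i} {j} i≢j Mji with M i j in Mij
    ... | false = refl
    ... | true  with u , _ , unique ← uniqueSink o (⁅ i ⁆ ∪ ⁅ j ⁆) s =
      ⊥-elim (Bool.not-¬ refl (begin
        lookup s j                     ≡⟨ cong (λ w → lookup w j) (trans
          (sym (unique (s-on , λ l _ → isSink matoušek l))) (unique (t-on , t-sink))) ⟩
        lookup t j                     ≡⟨ lookup-neighbour (neighbour s i) j ⟩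
        not (lookup (neighbour s i) j) ≡⟨ cong not (lookup-neighbour′ s (i≢j ∘ sym)) ⟩
        not (lookup s j)               ∎))
      where
      open ≡-Reasoning
      I = ⁅ i ⁆ ∪ ⁅ j ⁆
      t = neighbour (neighbour s i) j

      s-on : OnFace I s s
      s-on _ _ = refl

      t-on : OnFace I s t
      t-on l l∉I = trans
        (lookup-neighbour′ (neighbour s i) λ { refl → l∉I (x∈p∪q⁺ (inj₂ (x∈⁅x⁆ j))) })
        (lookup-neighbour′ s λ { refl → l∉I (x∈p∪q⁺ (inj₁ (x∈⁅x⁆ i))) })

      outmap-t : ∀ l → lookup (outmap o t) l ≡ M l i xor M l j
      outmap-t l = trans (outmap-neighbour matoušek (neighbour s i) j l)
        (cong (_xor M l j) (trans (outmap-neighbour matoušek s i l) (cong (_xor M l i) (isSink matoušek l))))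

      t-sink : ∀ l → l ∈ₛ I → lookup (outmap o t) l ≡ false
      t-sink l l∈I = trans (outmap-t l) (cancel (x∈p∪q⁻ ⁅ i ⁆ ⁅ j ⁆ l∈I))
        where
        cancel : l ∈ₛ ⁅ i ⁆ ⊎ l ∈ₛ ⁅ j ⁆ → M l i xor M l j ≡ false
        cancel (inj₁ l∈i) = subst (λ l → M l i xor M l j ≡ false) (sym (x∈⁅y⁆⇒x≡y i l∈i))
          (cong₂ _xor_ (influence-refl i) Mij)
        cancel (inj₂ l∈j) = subst (λ l → M l i xor M l j ≡ false) (sym (x∈⁅y⁆⇒x≡y j l∈j))
          (cong₂ _xor_ Mji (influence-refl j))

  branchingInfluence : BranchingInfluence o
  branchingInfluence = record
    { N = M
    ; N-outmap = outmap-neighbour matoušek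
    ; N-refl = influence-refl
    ; N-antisym = influence-antisym
    ; N-agree = influence-agree K realizable M (outmap-neighbour matoušek) influence-refl (isSink matoušek)
    }

-- The forest of influences

Node : ℕ → Set
Node n = Maybe (Fin n)

-- The default `false` is the parity of the empty path at the virtual node.
at : ∀ {n} → Vertex n → Node n → Bool
at v = maybe (lookup v) false

-- For a Matoušek-type outmap this is the linear part `M v`, free of the unknown sink.
response : ∀ {n} → USO n → Vertex n → Vertex n
response o v = outmap o v ⊕ outmap o (replicate _ false)

-- The parent of a root is nothing, a virtual node of depth 0.
record IsForest {n} (o : USO n) : Set where
  field
    parent     : Fin n → Node n
    depth      : Node n → ℕ
    depth-root : depth nothing ≡ 0
    depth-just : ∀ j → depth (just j) ≡ suc (depth (parent j))
    depth≤n    : ∀ x → depth x ≤ n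
    response-parent : ∀ v j →
      lookup (response o v) j ≡ lookup v j xor at (response o v) (parent j)

∣neighbour∣ : ∀ {n} (v : Vertex n) i → lookup v i ≡ false → ∣ neighbour v i ∣ ≡ suc ∣ v ∣
∣neighbour∣ (false ∷ v) zero    eq = refl
∣neighbour∣ (false ∷ v) (suc i) eq = ∣neighbour∣ v i eq
∣neighbour∣ (true  ∷ v) (suc i) eq = cong suc (∣neighbour∣ v i eq)

module _ {n} {o : USO n} (influence : BranchingInfluence o) where

  open BranchingInfluence influence

  Ancestor : Fin n → Fin n → Set
  Ancestor i j = i ≢ j × N j i ≡ true

  ancestor? : ∀ i j → Dec (Ancestor i j)
  ancestor? i j with i ≟ j | N j i Bool.≟ true
  ... | yes eq | _       = no λ (neq , _) → neq eq
  ... | no neq | yes Nji = yes (neq , Nji)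
  ... | no neq | no ¬Nji = no λ (_ , Nji) → ¬Nji Nji

  -- If `N i j` is false this is `N-agree`; otherwise antisymmetry forces `i` and `j` to coincide.
  N-trans : ∀ {i j k} → N j i ≡ true → N k j ≡ true → N k i ≡ true
  N-trans {i} {j} Nji Nkj with N i j in Nij
  ... | false = trans (N-agree Nkj Nij) Nji
  ... | true with i ≟ j
  ...   | yes refl = Nkj
  ...   | no i≢j with () ← trans (sym Nij) (N-antisym i≢j Nji)

  -- A scan that keeps the lowest ancestor met so far. It succeeds because two ancestors `i` and `l`
  -- of `j` are comparable: if `N l i` is false, then `N-agree` turns `N j l` into `N i l`.
  nearestAncestor : ∀ j (ls : List (Fin n)) →
    (∀ {l} → l ∈ ls → ¬ Ancestor l j) ⊎
    ∃[ i ] Ancestor i j × (∀ {l} → l ∈ ls → Ancestor l j → N i l ≡ true)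
  nearestAncestor j []       = inj₁ λ ()
  nearestAncestor j (l ∷ ls) with ancestor? l j | nearestAncestor j ls
  ... | no ¬l | inj₁ none = inj₁ λ { (here refl) → ¬l ; (there m) → none m }
  ... | no ¬l | inj₂ (i , anc , nearest) =
    inj₂ (i , anc , λ { (here refl) a → ⊥-elim (¬l a) ; (there m) → nearest m })
  ... | yes l-anc | inj₁ none =
    inj₂ (l , l-anc , λ { (here refl) _ → N-refl l ; (there m) a → ⊥-elim (none m a) })
  ... | yes l-anc | inj₂ (i , anc , nearest) with N l i in Nli
  ...   | true  = inj₂ (l , l-anc , λ { (here refl) _ → N-refl l ; (there m) a → N-trans (nearest m a) Nli })
  ...   | false = inj₂ (i , anc , λ { (here refl) _ → trans (sym (N-agree (proj₂ anc) Nli)) (proj₂ l-anc)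
                                     ; (there m) → nearest m })

  -- The path from the root, including the node itself since `N` is reflexive; its size serves as
  -- the depth.
  ancestors : Node n → Vertex n
  ancestors nothing  = replicate n false
  ancestors (just j) = tabulate (N j)

  -- The first component ensures that the flip inserts `j`: the path to `j` is the path to `p` with
  -- `j` appended.
  Parent : Fin n → Node n → Set
  Parent j p = lookup (ancestors p) j ≡ false × ancestors (just j) ≡ neighbour (ancestors p) j

  hasParent : ∀ j → ∃[ p ] Parent j p
  hasParent j with nearestAncestor j (allFin n)
  ... | inj₁ none = nothing , lookup-replicate j false , vertex-ext λ l →
    trans (lookup∘tabulate (N j) l) (row l)
    where
    row : ∀ l → N j l ≡ lookup (neighbour (replicate n false) j) l
    row l with l ≟ j
    ... | yes refl = trans (N-refl l) (sym (trans (lookup-neighbour (replicate n false) l)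
                       (cong not (lookup-replicate l false))))
    ... | no l≢j with N j l in Njl
    ...   | true  = ⊥-elim (none (∈-allFin l) (l≢j , Njl))
    ...   | false = sym (trans (lookup-neighbour′ (replicate n false) l≢j) (lookup-replicate l false))
  ... | inj₂ (i , (i≢j , Nji) , nearest) = just i , trans (lookup∘tabulate (N i) j) Nij , vertex-ext λ l →
    trans (lookup∘tabulate (N j) l) (row l)
    where
    Nij : N i j ≡ false
    Nij = N-antisym i≢j Nji

    -- Where `N-agree` does not apply, `l` is `i` or lies strictly below it. In the latter case
    -- `nearest` handles ancestors of `j` and antisymmetry all other nodes.
    agree : ∀ l → l ≢ j → N j l ≡ N i l
    agree l l≢j with N l i in Nli
    ... | false = N-agree Nji Nli
    ... | true with l ≟ i
    ...   | yes refl = trans Nji (sym (N-refl l))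
    ...   | no l≢i with N j l in Njl
    ...     | true  = sym (nearest (∈-allFin l) (l≢j , Njl))
    ...     | false = sym (N-antisym (l≢i ∘ sym) Nli)

    row : ∀ l → N j l ≡ lookup (neighbour (tabulate (N i)) j) l
    row l with l ≟ j
    ... | yes refl = trans (N-refl l) (sym (trans (lookup-neighbour (tabulate (N i)) l)
                       (cong not (trans (lookup∘tabulate (N i) l) Nij))))
    ... | no l≢j   = trans (agree l l≢j) (sym (trans (lookup-neighbour′ (tabulate (N i)) l≢j) (lookup∘tabulate (N i) l)))

  at-response-neighbour : ∀ v i x →
    at (response o (neighbour v i)) x ≡ at (response o v) x xor lookup (ancestors x) i
  at-response-neighbour v i nothing  = sym (lookup-replicate i false)
  at-response-neighbour v i (just j) = begin
    lookup (outmap o (neighbour v i) ⊕ r) j               ≡⟨ lookup-zipWith _xor_ j (outmap o (neighbour v i)) r ⟩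
    lookup (outmap o (neighbour v i)) j xor lookup r j    ≡⟨ cong (_xor lookup r j) (N-outmap v i j) ⟩
    (lookup (outmap o v) j xor N j i) xor lookup r j      ≡⟨ xy∙z≈xz∙y (lookup (outmap o v) j) _ _ ⟩
    (lookup (outmap o v) j xor lookup r j) xor N j i
      ≡⟨ cong₂ _xor_ (lookup-zipWith _xor_ j (outmap o v) r) (lookup∘tabulate (N j) i) ⟨
    lookup (response o v) j xor lookup (tabulate (N j)) i ∎
    where
    open ≡-Reasoning
    r = outmap o (replicate n false)

  private
    parent : Fin n → Node n
    parent j = proj₁ (hasParent j)

    -- All responses vanish at 0, and a flip of `i` changes both sides alike, because the paths to
    -- `j` and to its parent differ exactly in `j`.
    response-parent : ∀ v j → lookup (response o v) j ≡ lookup v j xor at (response o v) (parent j)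
    response-parent = cube-induction _ base step
      where
      open ≡-Reasoning

      zero-response : ∀ x → at (response o (replicate n false)) x ≡ false
      zero-response nothing  = refl
      zero-response (just j) = trans (lookup-zipWith _xor_ j (outmap o (replicate n false)) _)
        (Bool.xor-same (lookup (outmap o (replicate n false)) j))

      base : ∀ j → _
      base j = trans (zero-response (just j))
        (sym (cong₂ _xor_ (lookup-replicate j false) (zero-response (parent j))))

      step : ∀ v i → (∀ j → lookup (response o v) j ≡ lookup v j xor at (response o v) (parent j)) →
        ∀ j → lookup (response o (neighbour v i)) j ≡
          lookup (neighbour v i) j xor at (response o (neighbour v i)) (parent j)
      step v i ih j = begin
        lookup (response o (neighbour v i)) j
          ≡⟨ at-response-neighbour v i (just j) ⟩
        lookup (response o v) j xor lookup (ancestors (just j)) i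
          ≡⟨ cong₂ _xor_ (ih j) (trans (cong (λ u → lookup u i) (proj₂ (proj₂ (hasParent j))))
               (lookup-neighbour-xor (ancestors (parent j)) j i)) ⟩
        (v′ xor a) xor (b xor GF2.1ᴹ i j)
          ≡⟨ cong ((v′ xor a) xor_) (Bool.xor-comm b _) ⟩
        (v′ xor a) xor (GF2.1ᴹ i j xor b)
          ≡⟨ interchange v′ a (GF2.1ᴹ i j) b ⟩
        (v′ xor GF2.1ᴹ i j) xor (a xor b)
          ≡⟨ cong₂ _xor_ (trans (lookup-neighbour-xor v i j) (cong (v′ xor_) (1ᴹ-sym j i)))
               (at-response-neighbour v i (parent j)) ⟨
        lookup (neighbour v i) j xor at (response o (neighbour v i)) (parent j) ∎
        where
        v′ = lookup v j
        a  = at (response o v) (parent j)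
        b  = lookup (ancestors (parent j)) i

  isForest : IsForest o
  isForest = record
    { parent          = parent
    ; depth           = ∣_∣ ∘ ancestors
    ; depth-root      = ∣⊥∣≡0 n
    ; depth-just      = λ j → trans (cong ∣_∣ (proj₂ (proj₂ (hasParent j))))
                                (∣neighbour∣ (ancestors (parent j)) j (proj₁ (proj₂ (hasParent j))))
    ; depth≤n         = ∣p∣≤n ∘ ancestors
    ; response-parent = response-parent
    }

-- Divisibility by powers of two and binary digits

-- multiple k m tests whether 2 ^ k divides m, and digit k m is the k-th binary
-- digit of m.  Counting upwards, digit k flips exactly at the multiples of 2 ^ k.
multiple : ℕ → ℕ → Bool
digit    : ℕ → ℕ → Bool

multiple zero    m = true
multiple (suc k) m = multiple k m ∧ not (digit k m)

digit k zero    = false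
digit k (suc m) = multiple k (suc m) xor digit k m

multiple-0 : ∀ k → multiple k 0 ≡ true
multiple-0 zero    = refl
multiple-0 (suc k) = cong (_∧ true) (multiple-0 k)

module _ k (small : ∀ {m} → 0 < m → m < 2 ^ k → multiple k m ≡ false)
           (shift : ∀ m → multiple k (2 ^ k + m) ≡ multiple k m) where

  digit-small : ∀ {m} → m < 2 ^ k → digit k m ≡ false
  digit-small {zero}  _  = refl
  digit-small {suc m} lt = cong₂ _xor_ (small z<s lt) (digit-small (ℕ.<-trans (ℕ.n<1+n m) lt))

  digit-2^ : ∀ {p} → p ≡ 2 ^ k → digit k p ≡ true
  digit-2^ {zero}  eq with () ← subst (0 <_) (sym eq) (ℕ.m^n>0 2 k)
  digit-2^ {suc p} eq = cong₂ _xor_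
    (trans (cong (multiple k) (trans eq (sym (ℕ.+-identityʳ _)))) (trans (shift 0) (multiple-0 k)))
    (digit-small (ℕ.≤-reflexive eq))

  -- Shifting by `2 ^ k` keeps the positions of the flips but starts from the digit `true` at
  -- `2 ^ k`.
  digit-shift : ∀ m → digit k (2 ^ k + m) ≡ not (digit k m)
  digit-shift zero    = digit-2^ (ℕ.+-identityʳ _)
  digit-shift (suc m) = begin
    digit k (2 ^ k + suc m)                           ≡⟨ cong (digit k) (ℕ.+-suc (2 ^ k) m) ⟩
    multiple k (suc (2 ^ k + m)) xor digit k (2 ^ k + m)
      ≡⟨ cong₂ _xor_ (trans (cong (multiple k) (sym (ℕ.+-suc (2 ^ k) m))) (shift (suc m))) (digit-shift m) ⟩
    multiple k (suc m) xor not (digit k m)            ≡⟨ Bool.not-distribʳ-xor (multiple k (suc m)) _ ⟨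
    not (digit k (suc m))                             ∎
    where open ≡-Reasoning

-- Both claims go through one induction, since the digit lemmas at level `k` need both. A shift by
-- `2 ^ suc k` is two shifts by `2 ^ k`, which negate the digit twice.
multiple-small-shift : ∀ k → (∀ {m} → 0 < m → m < 2 ^ k → multiple k m ≡ false)
                           × (∀ m → multiple k (2 ^ k + m) ≡ multiple k m)
multiple-small-shift zero = (λ { (s≤s _) (s≤s ()) }) , λ _ → refl
multiple-small-shift (suc k) with small , shift ← multiple-small-shift k = small′ , shift′
  where
  small′ : ∀ {m} → 0 < m → m < 2 ^ suc k → multiple (suc k) m ≡ false
  small′ {m} 0<m m<2^ with m ℕ.<? 2 ^ k
  ... | yes m< = cong (_∧ not (digit k m)) (small 0<m m<)
  -- Here `m` lies in the upper half, so its digit is `true` and the second conjunct fails.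
  ... | no m≮ with r , refl ← ℕ.m≤n⇒∃[o]m+o≡n (ℕ.≮⇒≥ m≮) =
    trans (cong (λ d → multiple k (2 ^ k + r) ∧ not d)
        (trans (digit-shift k small shift r) (cong not (digit-small k small shift r<2^k))))
      (Bool.∧-zeroʳ _)
    where
    r<2^k : r < 2 ^ k
    r<2^k = subst (r <_) (ℕ.+-identityʳ (2 ^ k)) (ℕ.+-cancelˡ-< (2 ^ k) r _ m<2^)

  shift′ : ∀ m → multiple (suc k) (2 ^ suc k + m) ≡ multiple (suc k) m
  shift′ m = begin
    multiple (suc k) (2 ^ suc k + m)
      ≡⟨ cong (multiple (suc k)) (trans (ℕ.+-assoc (2 ^ k) _ m)
           (cong (λ p → 2 ^ k + (p + m)) (ℕ.+-identityʳ (2 ^ k)))) ⟩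
    multiple (suc k) (2 ^ k + (2 ^ k + m))
      ≡⟨ cong₂ (λ a d → a ∧ not d) (trans (shift _) (shift m))
           (trans (digit-shift k small shift _)
             (trans (cong not (digit-shift k small shift m)) (Bool.not-involutive _))) ⟩
    multiple (suc k) m ∎
    where open ≡-Reasoning

-- Queries with intermediate results and exact costs

record Query (n : ℕ) (A : Set) : Set where
  no-eta-equality
  -- An `Algorithm` outputs only vertices; continuations let a subroutine return values of any type.
  field then : (A → Algorithm n) → Algorithm n

open Query

module _ {n : ℕ} where

  return : ∀ {A} → A → Query n A
  return a .then continue = continue a

  infixl 1 _>>=_
  _>>=_ : ∀ {A B} → Query n A → (A → Query n B) → Query n B
  (m >>= f) .then continue = m .then λ a → f a .then continue

  -- The reference b is the answer at 0, which turns answers into responses.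
  respond : Vertex n → Vertex n → Query n (Vertex n)
  respond b v .then continue = evaluate v λ a → continue (a ⊕ b)

  respondAll : Vertex n → ∀ {L} → Vec (Vertex n) L → Query n (Vec (Vertex n) L)
  respondAll b []       = return []
  respondAll b (v ∷ vs) = respond b v >>= λ a → respondAll b vs >>= λ as → return (a ∷ as)

  -- Quantifying over the continuation makes costs add up under `>>=`.
  record Returns (o : USO n) {A : Set} (m : Query n A) (cost : ℕ) (P : A → Set) : Set where
    constructor returns
    field
      {value} : A
      correct : P value
      run     : ∀ continue → result (m .then continue) o ≡ result (continue value) o
                  × evaluations (m .then continue) o ≡ cost + evaluations (continue value) o

  open Returns

  returns-return : ∀ {o : USO n} {A P} {a : A} → P a → Returns o (return a) 0 P
  returns-return p = returns p λ _ → refl , refl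

  returns->>= : ∀ {o : USO n} {A B P Q c c′} {m : Query n A} {f : A → Query n B} →
    Returns o m c P → (∀ {a} → P a → Returns o (f a) c′ Q) → Returns o (m >>= f) (c + c′) Q
  returns->>= {o} {c = c} {c′} {m} {f} (returns {a} p run) next = returns (correct next-a) λ continue →
      trans (proj₁ (run _)) (proj₁ (Returns.run next-a continue))
    , trans (proj₂ (run λ a → f a .then continue))
        (trans (cong (c +_) (proj₂ (Returns.run next-a continue))) (sym (ℕ.+-assoc c c′ _)))
    where next-a = next p

  returns-cost : ∀ {o : USO n} {A P c c′} {m : Query n A} → c ≡ c′ → Returns o m c P → Returns o m c′ P
  returns-cost refl r = r

  returns-respond : ∀ (o : USO n) v →
    Returns o (respond (outmap o (replicate n false)) v) 1 (_≡ response o v)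
  returns-respond o v = returns refl λ _ → refl , refl

  returns-respondAll : ∀ (o : USO n) {L} (vs : Vec (Vertex n) L) →
    Returns o (respondAll (outmap o (replicate n false)) vs) L (_≡ map (response o) vs)
  returns-respondAll o []       = returns-return refl
  returns-respondAll o {suc L} (v ∷ vs) = returns-cost (cong suc (ℕ.+-identityʳ L))
    (returns->>= (returns-respond o v) λ eq →
      returns->>= (returns-respondAll o vs) λ eqs → returns-return (cong₂ _∷_ eq eqs))

-- The algorithm

module _ {n L} (code : Fin n → Fin L → Bool) where

  decode : (Fin L → Bool) → Node n
  decode w with any? (λ i → all? λ t → w t Bool.≟ code i t)
  ... | yes (i , _) = just i
  ... | no _        = nothing

  decode-code : (∀ {i j} → code i ≗ code j → i ≡ j) →
    ∀ {w i} → w ≗ code i → decode w ≡ just i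
  decode-code code-injective {w} {i} eq with any? (λ i → all? λ t → w t Bool.≟ code i t)
  ... | yes (j , eq′) = cong just (code-injective λ t → trans (sym (eq′ t)) (eq t))
  ... | no none       = ⊥-elim (none (i , eq))

  -- If v holds the nodes of depth divisible by 2 ^ k and b the k-th binary digits
  -- of the depths, these are the nodes whose depth is an odd multiple of 2 ^ k and
  -- whose code contains t.
  probe : Vertex n → Vertex n → Fin L → Vertex n
  probe v b t = tabulate λ i → (lookup v i ∧ lookup b i) ∧ code i t

  -- The condition is the `k`-th digit of the depth of `j`'s parent. If it is set, an odd multiple
  -- of `2 ^ k` lies below the coarse ancestor. Xoring out the probe bit of `j` and the answer at
  -- that ancestor leaves the parities strictly between them, which spell its code.
  refine : Vertex n → Vertex n → Vec (Node n) n → Vec (Vertex n) L → Fin n → Node n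
  refine v b coarse answers j =
    if lookup v j xor lookup b j
    then decode (λ t → (lookup (lookup answers t) j xor lookup (probe v b t) j)
                         xor at (lookup answers t) (lookup coarse j))
    else lookup coarse j

  -- The nearest proper ancestors of depth divisible by 2 ^ k, where v holds all
  -- nodes of such depth; no depth is divisible by 2 ^ (k + f).
  ancestorTable : Vertex n → ℕ → Vertex n → Query n (Vec (Node n) n)
  -- At the top level only the virtual node has a depth divisible by the power of two.
  ancestorTable b₀ zero    v = return (replicate n nothing)
  ancestorTable b₀ (suc f) v =
    respond b₀ v >>= λ b →
    -- A multiple of `2 ^ k` whose `k`-th digit is 0 is a multiple of `2 ^ suc k`.
    ancestorTable b₀ f (tabulate λ j → lookup v j ∧ not (lookup b j)) >>= λ coarse →
    respondAll b₀ (tabulate (probe v b)) >>= λ answers →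
    return (tabulate (refine v b coarse answers))

  findSink : ℕ → Algorithm n
  findSink K = evaluate (replicate n false) λ b₀ →
    ancestorTable b₀ K (replicate n true) .then λ parents →
    output (tabulate λ j → lookup b₀ j xor at b₀ (lookup parents j))

  -- Correctness and cost of the algorithm

  module _ (code-injective : ∀ {i j} → code i ≗ code j → i ≡ j)
           {o : USO n} (forest : IsForest o) where

    open IsForest forest

    private
      b₀ = outmap o (replicate n false)

    -- The parent is not structurally smaller, so the recursion runs on the depth.
    node-induction : ∀ {p} (P : Node n → Set p) → P nothing →
      (∀ j → P (parent j) → P (just j)) → ∀ x → P x
    node-induction P base step x = go (depth x) x refl
      where
      go : ∀ d x → depth x ≡ d → P x
      go d       nothing  eq = base
      go zero    (just j) eq with () ← trans (sym eq) (depth-just j)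
      go (suc d) (just j) eq = step j (go d (parent j) (ℕ.suc-injective (trans (sym (depth-just j)) eq)))

    -- The node itself qualifies; proper ancestors of `j` arise by starting at `parent j`.
    data Nearest (k : ℕ) : Node n → Node n → Set where
      root  : Nearest k nothing nothing
      here  : ∀ {j} → multiple k (depth (just j)) ≡ true → Nearest k (just j) (just j)
      above : ∀ {j x} → multiple k (depth (just j)) ≡ false →
              Nearest k (parent j) x → Nearest k (just j) x

    digit-just : ∀ k j → digit k (depth (just j)) ≡ multiple k (depth (just j)) xor digit k (depth (parent j))
    digit-just k j rewrite depth-just j = refl

    digit-root : ∀ k → digit k (depth nothing) ≡ false
    digit-root k = cong (digit k) depth-root

    module _ {k} {v : Vertex n} (v-multiple : ∀ j → lookup v j ≡ multiple k (depth (just j))) where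

      b : Vertex n
      b = response o v

      -- The path to `x` meets each depth from 1 to `depth x` once, and the parity of the number of
      -- multiples of `2 ^ k` among these is the `k`-th digit.
      response-digit : ∀ x → at b x ≡ digit k (depth x)
      response-digit = node-induction _ (sym (digit-root k)) λ j ih →
        trans (response-parent v j) (trans (cong₂ _xor_ (v-multiple j) ih) (sym (digit-just k j)))

      digit-parent : ∀ j → lookup v j xor lookup b j ≡ digit k (depth (parent j))
      digit-parent j = trans (cong (lookup v j xor_) (response-parent v j))
        (trans (xor-cancelˡ (lookup v j) _) (response-digit (parent j)))

      r : Fin L → Vertex n
      r t = response o (probe v b t)

      probe-value : ∀ t j → lookup (probe v b t) j ≡
        (multiple k (depth (just j)) ∧ digit k (depth (just j))) ∧ code j t
      probe-value t j = trans (lookup∘tabulate _ j)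
        (cong₂ (λ x y → (x ∧ y) ∧ code j t) (v-multiple j) (response-digit (just j)))

      -- The alternatives: strictly below `u`, the path to `x` has no node whose depth is an odd
      -- multiple of `2 ^ k`, or exactly one, `i`, whose code is then the difference of the probe
      -- parities.
      Refinement : Node n → Node n → Set
      Refinement x u =
          (digit k (depth x) ≡ false × Nearest k x u × (∀ t → at (r t) x ≡ at (r t) u))
        ⊎ (digit k (depth x) ≡ true × ∃[ i ] Nearest k x (just i)
             × (∀ t → at (r t) x xor at (r t) u ≡ code i t))

      -- Induction down the path from `u`: between two odd multiples of `2 ^ k` there is a multiple
      -- of `2 ^ suc k`, so at most one occurs before the path ends.
      refinement : ∀ {x u} → Nearest (suc k) x u → Refinement x u
      refinement root = inj₁ (digit-root k , root , λ _ → refl)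
      refinement (here {j} eq) with multiple k (depth (just j)) in mult | digit k (depth (just j)) in dig
      ... | true | false = inj₁ (refl , here mult , λ _ → refl)
      refinement {u = u} (above {j} eq near) with multiple k (depth (just j)) in mult
      -- No probe contains `j`, so digit and parities are inherited from the parent.
      ... | false = [ (λ (dig , near′ , same) → inj₁
                        (trans digit-same dig , above mult near′ , λ t → trans (r-same t) (same t)))
                    , (λ (dig , i , near′ , diff) → inj₂
                        (trans digit-same dig , i , above mult near′ ,
                         λ t → trans (cong (_xor at (r t) u) (r-same t)) (diff t))) ]′
                    (refinement near)
        where
        digit-same : digit k (depth (just j)) ≡ digit k (depth (parent j))
        digit-same = trans (digit-just k j) (cong (_xor digit k (depth (parent j))) mult)

        r-same : ∀ t → at (r t) (just j) ≡ at (r t) (parent j)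
        r-same t = trans (response-parent (probe v b t) j) (cong (_xor at (r t) (parent j))
          (trans (probe-value t j) (cong (λ a → (a ∧ digit k (depth (just j))) ∧ code j t) mult)))
      ... | true with refinement near
      -- Here `j` itself is the odd multiple, and its own probe bits are the whole difference.
      ...   | inj₁ (dig , _ , same) = inj₂ (digit-j , j , here mult , λ t → begin
                at (r t) (just j) xor at (r t) u
                  ≡⟨ cong (_xor at (r t) u) (response-parent (probe v b t) j) ⟩
                (lookup (probe v b t) j xor at (r t) (parent j)) xor at (r t) u
                  ≡⟨ cong (λ a → (lookup (probe v b t) j xor a) xor at (r t) u) (same t) ⟩
                (lookup (probe v b t) j xor at (r t) u) xor at (r t) u
                  ≡⟨ xor-cancelʳ _ (at (r t) u) ⟩
                lookup (probe v b t) j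
                  ≡⟨ trans (probe-value t j) (cong₂ (λ x y → (x ∧ y) ∧ code j t) mult digit-j) ⟩
                code j t ∎)
        where
        open ≡-Reasoning
        digit-j : digit k (depth (just j)) ≡ true
        digit-j = trans (digit-just k j) (cong₂ _xor_ mult dig)
      -- After an odd multiple, the next multiple of `2 ^ k` has digit 0 and is divisible by
      -- `2 ^ suc k`, contrary to `eq`.
      ...   | inj₂ (dig , _) with () ← trans (sym eq) (cong not (trans (digit-just k j) (cong₂ _xor_ mult dig)))

      refine-nearest : ∀ {coarse answers} → (∀ j → Nearest (suc k) (parent j) (lookup coarse j)) →
        (∀ t → lookup answers t ≡ r t) → ∀ j → Nearest k (parent j) (refine v b coarse answers j)
      refine-nearest {coarse} {answers} near eq j with refinement (near j)
      ... | inj₁ (dig , near′ , _) rewrite trans (digit-parent j) dig = near′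
      ... | inj₂ (dig , i , near′ , diff) rewrite trans (digit-parent j) dig =
        subst (Nearest k (parent j)) (sym (decode-code code-injective λ t → begin
          (lookup (lookup answers t) j xor lookup (probe v b t) j)
              xor at (lookup answers t) (lookup coarse j)
            ≡⟨ cong (λ a → (lookup a j xor lookup (probe v b t) j) xor at a (lookup coarse j)) (eq t) ⟩
          (lookup (r t) j xor lookup (probe v b t) j) xor at (r t) (lookup coarse j)
            ≡⟨ cong (_xor at (r t) (lookup coarse j)) (trans (Bool.xor-comm (lookup (r t) j) _)
                 (trans (cong (lookup (probe v b t) j xor_) (response-parent (probe v b t) j))
                   (xor-cancelˡ (lookup (probe v b t) j) _))) ⟩
          at (r t) (parent j) xor at (r t) (lookup coarse j)
            ≡⟨ diff t ⟩
          code i t ∎)) near′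
        where open ≡-Reasoning

    -- Induction on the number `f` of remaining levels. Each level costs one evaluation for the
    -- digits and `L` for the code bits.
    ancestorTable-nearest : ∀ {K} → (∀ j → multiple K (depth (just j)) ≡ false) →
      ∀ f k → k + f ≡ K → ∀ {v} → (∀ j → lookup v j ≡ multiple k (depth (just j))) →
      Returns o (ancestorTable b₀ f v) (f * suc L) (λ table → ∀ j → Nearest k (parent j) (lookup table j))
    ancestorTable-nearest {K} none zero k k≡K v-multiple = returns-return λ j →
      subst (Nearest k (parent j)) (sym (lookup-replicate j nothing)) (nearest-nothing (parent j))
      where
      nearest-nothing : ∀ x → Nearest k x nothing
      nearest-nothing = node-induction _ root λ j →
        above (subst (λ l → multiple l (depth (just j)) ≡ false)
          (sym (trans (sym (ℕ.+-identityʳ k)) k≡K)) (none j))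
    ancestorTable-nearest {K} none (suc f) k k+f≡K {v} v-multiple =
      returns-cost cost
        (returns->>= (returns-respond o v) λ { refl →
          returns->>= (ancestorTable-nearest none f (suc k) (trans (sym (ℕ.+-suc k f)) k+f≡K) λ j →
              trans (lookup∘tabulate _ j)
                (cong₂ (λ x y → x ∧ not y) (v-multiple j) (response-digit v-multiple (just j))))
            λ {coarse} near → returns->>= (returns-respondAll o probes) λ { refl → returns-return λ j →
              subst (Nearest k (parent j)) (sym (lookup∘tabulate _ j))
                (refine-nearest {v = v} v-multiple {coarse} {map (response o) probes} near
                  (λ t → trans (lookup-map t (response o) probes) (cong (response o) (lookup∘tabulate _ t))) j) } })
      where
      probes : Vec (Vertex n) L
      probes = tabulate (probe v (response o v))

      cost : 1 + (f * suc L + (L + 0)) ≡ suc f * suc L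
      cost = cong suc (trans (cong (f * suc L +_) (ℕ.+-identityʳ L)) (ℕ.+-comm _ L))

    -- Every depth is a multiple of 1, so `above` cannot occur.
    nearest-0 : ∀ {x u} → Nearest 0 x u → u ≡ x
    nearest-0 root     = refl
    nearest-0 (here _) = refl

    module _ {K} (n<2^K : n < 2 ^ K) where

      private
        table : Returns o (ancestorTable b₀ K (replicate n true)) (K * suc L)
                  (λ table → ∀ j → Nearest 0 (parent j) (lookup table j))
        table = ancestorTable-nearest
          (λ j → proj₁ (multiple-small-shift K)
            (subst (0 <_) (sym (depth-just j)) z<s) (ℕ.≤-<-trans (depth≤n (just j)) n<2^K))
          K 0 refl (λ j → lookup-replicate j true)

        s : Vertex n
        s = tabulate λ j → lookup b₀ j xor at b₀ (lookup (Returns.value table) j)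

      findSink-evaluations : evaluations (findSink K) o ≡ suc (K * suc L)
      findSink-evaluations = cong suc (trans (proj₂ (Returns.run table _)) (ℕ.+-identityʳ _))

      -- The response at `s` is `b₀`, the answer at 0, which means that the answer at `s` itself is
      -- 0.
      findSink-sink : IsSink o (result (findSink K) o)
      findSink-sink i = trans (cong (λ w → lookup (outmap o w) i) (proj₁ (Returns.run table _))) (begin
          lookup (outmap o s) i                                 ≡⟨ xor-cancelʳ _ (lookup b₀ i) ⟨
          (lookup (outmap o s) i xor lookup b₀ i) xor lookup b₀ i
            ≡⟨ cong (_xor lookup b₀ i) (lookup-zipWith _xor_ i (outmap o s) b₀) ⟨
          lookup (response o s) i xor lookup b₀ i               ≡⟨ cong (_xor lookup b₀ i) (response-s (just i)) ⟩
          lookup b₀ i xor lookup b₀ i                           ≡⟨ Bool.xor-same (lookup b₀ i) ⟩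
          false                                                 ∎)
        where
        open ≡-Reasoning

        -- `s` consists of the differences of `b₀` along parent edges, so its path parities
        -- telescope to `b₀`.
        response-s : ∀ x → at (response o s) x ≡ at b₀ x
        response-s = node-induction _ refl λ j ih → begin
          lookup (response o s) j ≡⟨ response-parent s j ⟩
          lookup s j xor at (response o s) (parent j)
            ≡⟨ cong₂ _xor_ (trans (lookup∘tabulate _ j)
                 (cong (λ x → lookup b₀ j xor at b₀ x) (nearest-0 (Returns.correct table j)))) ih ⟩
          (lookup b₀ j xor at b₀ (parent j)) xor at b₀ (parent j) ≡⟨ xor-cancelʳ _ (at b₀ (parent j)) ⟩
          lookup b₀ j ∎

-- Binary codes and the final bound

funToFin-cong : ∀ {m n} {f g : Fin m → Fin n} → f ≗ g → funToFin f ≡ funToFin g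
funToFin-cong {zero}  f≗g = refl
funToFin-cong {suc m} f≗g = cong₂ combine (f≗g zero) (funToFin-cong (f≗g ∘ suc))

binary : ∀ {n L} → n ≤ 2 ^ L → Fin n → Fin L → Bool
binary n≤2^L i t = Inverse.to 2↔Bool (finToFun (inject≤ i n≤2^L) t)

binary-injective : ∀ {n L} (n≤2^L : n ≤ 2 ^ L) {i j} → binary n≤2^L i ≗ binary n≤2^L j → i ≡ j
binary-injective {n} {L} n≤2^L {i} {j} eq = inject≤-injective n≤2^L n≤2^L i j (begin
  inject≤ i n≤2^L                       ≡⟨ funToFin-finToFin {L} {2} (inject≤ i n≤2^L) ⟨
  funToFin {L} (finToFun (inject≤ i n≤2^L)) ≡⟨ funToFin-cong {L} (λ t → Injection.injective (↔⇒↣ 2↔Bool) (eq t)) ⟩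
  funToFin {L} (finToFun (inject≤ j n≤2^L)) ≡⟨ funToFin-finToFin {L} {2} (inject≤ j n≤2^L) ⟩
  inject≤ j n≤2^L                       ∎)
  where open ≡-Reasoning

-- Otherwise monotonicity of the logarithm would put `suc ⌊log₂ n ⌋` below `⌊log₂ n ⌋`.
n<2^[1+⌊log₂n⌋] : ∀ n → n < 2 ^ suc ⌊log₂ n ⌋
n<2^[1+⌊log₂n⌋] n = ℕ.≰⇒> λ 2^≤n → ℕ.1+n≰n
  (subst (_≤ ⌊log₂ n ⌋) (⌊log₂[2^n]⌋≡n (suc ⌊log₂ n ⌋)) (⌊log₂⌋-mono-≤ 2^≤n))

-- Bounding every constant 1 by `ℓ` gives `ℓ² + 2ℓ · 3ℓ = 7ℓ²`.
query-bound : ∀ ℓ → 1 ≤ ℓ → suc (suc ℓ * suc (suc ℓ)) ≤ 7 * ℓ ^ 2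
query-bound ℓ 1≤ℓ = begin
  1 + suc ℓ * suc (suc ℓ)
    ≤⟨ ℕ.+-mono-≤ (ℕ.*-mono-≤ 1≤ℓ 1≤ℓ)
         (ℕ.*-mono-≤ (ℕ.+-monoˡ-≤ ℓ 1≤ℓ) (ℕ.+-mono-≤ 1≤ℓ (ℕ.+-monoˡ-≤ ℓ 1≤ℓ))) ⟩
  ℓ * ℓ + (ℓ + ℓ) * (ℓ + (ℓ + ℓ))
    ≡⟨ solve 1 (λ ℓ → ℓ :* ℓ :+ (ℓ :+ ℓ) :* (ℓ :+ (ℓ :+ ℓ)) := con 7 :* (ℓ :* (ℓ :* con 1))) refl ℓ ⟩
  7 * ℓ ^ 2 ∎
  where
  open ℕ.≤-Reasoning
  open ℕ.+-*-Solver

theorem2 : ∀ {c ℓ₁ ℓ₂} (K : OrderedField c ℓ₁ ℓ₂) →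
    Σ[ algorithm ∈ (∀ n → Algorithm n) ]
    (∀ n (o : USO n) → IsMatoušekType o → IsRealizable K o →
    IsSink o (result (algorithm n) o))
    × ∃[ C ] ∃[ n₀ ] (∀ n → n₀ ≤ n →
    ∀ (o : USO n) → IsMatoušekType o → IsRealizable K o →
    evaluations (algorithm n) o ≤ C * ⌊log₂ n ⌋ ^ 2)
theorem2 K =
    (λ n → findSink (code n) (size n))
  , (λ n o matoušek realizable → findSink-sink (code n) (code-injective n)
       (isForest (branchingInfluence K matoušek realizable)) {size n} (n<2^[1+⌊log₂n⌋] n))
  -- `query-bound` supplies the 7; `2 ≤ n` makes the logarithm at least 1, as that bound requires.
  , 7 , 2 , λ n 2≤n o matoušek realizable → ℕ.≤-trans
      (ℕ.≤-reflexive (findSink-evaluations (code n) (code-injective n)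
        (isForest (branchingInfluence K matoušek realizable)) {size n} (n<2^[1+⌊log₂n⌋] n)))
      (query-bound ⌊log₂ n ⌋ (⌊log₂⌋-mono-≤ 2≤n))
  where
  -- Serves both as the number of levels, where `2 ^ size n` must exceed all depths, and as the code
  -- length.
  size : ℕ → ℕ
  size n = suc ⌊log₂ n ⌋

  code : ∀ n → Fin n → Fin (size n) → Bool
  code n = binary (ℕ.<⇒≤ (n<2^[1+⌊log₂n⌋] n))

  code-injective : ∀ n {i j} → code n i ≗ code n j → i ≡ j
  code-injective n = binary-injective (ℕ.<⇒≤ (n<2^[1+⌊log₂n⌋] n))
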